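{- Let $(I,\preccurlyeq)$ be a directed set, let $S(\Lambda^{\preccurlyeq})$ be a direct spectrum over $(I,\preccurlyeq)$ with sets $\lambda_0(i)$, transports $\lambda^{\preccurlyeq}_{ij}$ and Bishop spaces $\mathcal F_i=(\lambda_0(i),F_i)$, and let $\mathcal F=(X,F)$ be a Bishop space. Let $S(\Lambda^{\preccurlyeq})\to\mathcal F$ be the contravariant direct spectrum over $(I,\preccurlyeq)$ with sets $\mathrm{Mor}(\mathcal F_i,\mathcal F)$, transports $(\lambda^{\preccurlyeq}_{ij})^+:\mathrm{Mor}(\mathcal F_j,\mathcal F)\to\mathrm{Mor}(\mathcal F_i,\mathcal F)$, $\phi\mapsto\phi\circ\lambda^{\preccurlyeq}_{ij}$ (for $i\preccurlyeq j$), and Bishop spaces $\mathcal F_i\to\mathcal F$. Then $\underset{\leftarrow}{\mathrm{Lim}}\,(\mathcal F_i\to\mathcal F)\simeq(\underset{\to}{\mathrm{Lim}}\,\mathcal F_i)\to\mathcal F$.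
   Context: Work in Bishop-style constructive mathematics. A directed set: a set with a reflexive transitive relation respecting equality, any two elements having a common upper bound. A direct family over $(I,\preccurlyeq)$: sets $\lambda_0(i)$ and functions $\lambda^{\preccurlyeq}_{ij}:\lambda_0(i)\to\lambda_0(j)$ for $i\preccurlyeq j$ with $\lambda^{\preccurlyeq}_{ii}=\mathrm{id}$ and $\lambda^{\preccurlyeq}_{ik}=\lambda^{\preccurlyeq}_{jk}\circ\lambda^{\preccurlyeq}_{ij}$. A contravariant direct family: sets $\mu_0(i)$ and functions $\mu^{\succcurlyeq}_{ji}:\mu_0(j)\to\mu_0(i)$ for $i\preccurlyeq j$ with $\mu^{\succcurlyeq}_{ii}=\mathrm{id}$, $\mu^{\succcurlyeq}_{ki}=\mu^{\succcurlyeq}_{ji}\circ\mu^{\succcurlyeq}_{kj}$. Bishop spaces: a Bishop topology on $X$ is a set $F$ of functions $X\to\mathbb R$ containing constants, closed under addition, composition with functions $\mathbb R\to\mathbb R$ uniformly continuous on every $[-n,n]$, and uniform limits; $\bigvee F_0$ = least Bishop topology containing $F_0$; Bishop morphism $(X,F)\to(Y,G)$: a function $h$ with $g\circ h\in F$ for all $g\in G$; Bishop isomorphism: bijective morphism with morphism inverse; $\simeq$: Bishop isomorphic. Exponential: $\mathcal F\to\mathcal G=(\mathrm{Mor}(\mathcal F,\mathcal G),\bigvee\{\phi_{x,g}:x\in X,g\in G\})$, $\phi_{x,g}(h)=g(h(x))$. A (contravariant) direct spectrum: a (contravariant) direct family with Bishop topologies on each set making all transports Bishop morphisms. Direct limit: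 $\sum^{\preccurlyeq}\lambda_0(i)$ = pairs $(i,x)$ with $(i,x)=(j,y)$ iff there is $k\succcurlyeq i,j$ with $\lambda^{\preccurlyeq}_{ik}(x)=\lambda^{\preccurlyeq}_{jk}(y)$; $\prod^{\succcurlyeq}F_i$ = dependent assignments $\Theta$ with $\Theta_i\in F_i$ and $\Theta_i=\Theta_j\circ\lambda^{\preccurlyeq}_{ij}$ for $i\preccurlyeq j$; $\underset{\to}{\mathrm{Lim}}\,\lambda_0(i)$ = classes $\mathrm{eql}_0(i,x)$ under that equality; $\mathrm{eql}_0f_\Theta(\mathrm{eql}_0(i,x))=\Theta_i(x)$; $\underset{\to}{\mathrm{Lim}}\,\mathcal F_i=(\underset{\to}{\mathrm{Lim}}\,\lambda_0(i),\bigvee\{\mathrm{eql}_0f_\Theta:\Theta\in\prod^{\succcurlyeq}F_i\})$. Inverse limit of a contravariant spectrum with sets $\mu_0(i)$, transports $\mu^{\succcurlyeq}_{ji}$, topologies $G_i$: $\prod^{\succcurlyeq}\mu_0(i)$ = dependent assignments $\Phi$ with $\Phi_i\in\mu_0(i)$, $\Phi_i=\mu^{\succcurlyeq}_{ji}(\Phi_j)$ for $i\preccurlyeq j$ (pointwise equality); $\pi_i(\Phi)=\Phi_i$; $\underset{\leftarrow}{\mathrm{Lim}}\,\mathcal G_i=(\prod^{\succcurlyeq}\mu_0(i),\bigvee\{g\circ\pi_i:i\in I,g\in G_i\})$. -}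

module Defs where

open import Data.Empty using (⊥)
open import Data.Integer.Base as ℤ using (+_; +[1+_])
import Data.Integer.Properties as ℤ
open import Data.Nat.Base as ℕ using (ℕ; suc)
import Data.Nat.Properties as ℕ
import Data.Nat.Solver as ℕSolver
open import Data.Product using (_×_; _,_; Σ; Σ-syntax; ∃-syntax)
open import Data.Rational.Base as ℚ using (ℚ; mkℚ)
import Data.Rational.Properties as ℚ
import Data.Rational.Solver as ℚSolver
import Data.Rational.Unnormalised.Base as ℚᵘ
import Data.Rational.Unnormalised.Properties as ℚᵘ
open import Data.Sum using (inj₁; inj₂)
open import Function.Bundles using (Func; _⟨$⟩_)
import Function.Construct.Composition as Composition
import Function.Construct.Identity as Identity
open import Function.Definitions using (Inverseᵇ)
open import Function.Relation.Binary.Setoid.Equality using (_⇨_)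
open import Level using (Level; 0ℓ; _⊔_) renaming (suc to lsuc)
open import Relation.Binary.Bundles using (Preorder; Setoid)
import Relation.Binary.Construct.On as On
open import Relation.Binary.PropositionalEquality
  using (_≡_; refl; sym; trans; cong; cong₂; subst; subst₂)
open import Relation.Unary using (Pred; _∈_)

private
  variable
    a b c ℓ ℓ₁ ℓ₂ ℓ₃ p q r : Level

------------------------------------------------------------------------
-- Rational estimates

-- Sequences are indexed from 0, so the n-th error bound is 1/(n+1).
δ : ℕ → ℚ
δ n = + 1 ℚ./ suc n

double : ℕ → ℕ
double n = suc (n ℕ.+ n)

private

  0≤δ : ∀ n → ℚ.0ℚ ℚ.≤ δ n
  0≤δ n = ℚ.<⇒≤ (ℚ.positive⁻¹ (δ n) {{ℚ.normalize-pos 1 (suc n)}})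

  δ-half : ∀ n → δ (double n) ℚ.+ δ (double n) ≡ δ n
  δ-half n = ℚ.toℚᵘ-injective (begin
    ℚ.toℚᵘ (δ (double n) ℚ.+ δ (double n))
      ≈⟨ ℚ.toℚᵘ-homo-+ (δ (double n)) (δ (double n)) ⟩
    ℚ.toℚᵘ (δ (double n)) ℚᵘ.+ ℚ.toℚᵘ (δ (double n))
      ≈⟨ ℚᵘ.+-cong (ℚ.toℚᵘ-fromℚᵘ h) (ℚ.toℚᵘ-fromℚᵘ h) ⟩
    h ℚᵘ.+ h
      ≈⟨ ℚᵘ.*≡* (cong +_ (solve 1 (λ m →
           (con 1 :* (con 2 :+ (m :+ m)) :+ con 1 :* (con 2 :+ (m :+ m))) :* (con 1 :+ m)
           := con 1 :* ((con 2 :+ (m :+ m)) :* (con 2 :+ (m :+ m)))) refl n)) ⟩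
    ℚᵘ.mkℚᵘ (+ 1) n
      ≈⟨ ℚ.toℚᵘ-fromℚᵘ (ℚᵘ.mkℚᵘ (+ 1) n) ⟨
    ℚ.toℚᵘ (δ n) ∎)
    where
    open ℚᵘ.≃-Reasoning
    open ℕSolver.+-*-Solver
    h = ℚᵘ.mkℚᵘ (+ 1) (double n)

  archimedean : ∀ t → (∀ m → t ℚ.≤ δ m) → t ℚ.≤ ℚ.0ℚ
  archimedean t t≤δ = ℚ.≮⇒≥ (λ 0<t → impossible t (ℚ.positive 0<t) t≤δ)
    where
    impossible : ∀ t → ℚ.Positive t → (∀ m → t ℚ.≤ δ m) → ⊥
    impossible s@(mkℚ +[1+ n ] d _) _ s≤δ
      with ℚᵘ.≤-respʳ-≃ (ℚ.toℚᵘ-fromℚᵘ (ℚᵘ.mkℚᵘ (+ 1) (suc d)))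
                        (ℚ.toℚᵘ-mono-≤ (s≤δ (suc d)))
    ... | ℚᵘ.*≤* (ℤ.+≤+ le) = ℕ.<-irrefl refl (begin-strict
        1 ℕ.* suc d             ≡⟨ ℕ.*-identityˡ (suc d) ⟩
        suc d                   <⟨ ℕ.n<1+n (suc d) ⟩
        suc (suc d)             ≤⟨ ℕ.m≤m+n (suc (suc d)) (n ℕ.* suc (suc d)) ⟩
        suc n ℕ.* suc (suc d)   ≤⟨ le ⟩
        1 ℕ.* suc d             ∎)
      where open ℕ.≤-Reasoning

  ∣∣-lub : ∀ {s t} → t ℚ.≤ s → ℚ.- t ℚ.≤ s → ℚ.∣ t ∣ ℚ.≤ s
  ∣∣-lub {s} {t} t≤s -t≤s with ℚ.∣p∣≡p∨∣p∣≡-p t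
  ... | inj₁ eq = subst (ℚ._≤ s) (sym eq) t≤s
  ... | inj₂ eq = subst (ℚ._≤ s) (sym eq) -t≤s

  ∣-∣-sym : ∀ s t → ℚ.∣ s ℚ.- t ∣ ≡ ℚ.∣ t ℚ.- s ∣
  ∣-∣-sym s t = trans (sym (ℚ.∣-p∣≡∣p∣ (s ℚ.- t)))
    (cong ℚ.∣_∣ (solve 2 (λ s t → :- (s :- t) := t :- s) refl s t))
    where open ℚSolver.+-*-Solver

  triangle : ∀ s t u → ℚ.∣ s ℚ.- u ∣ ℚ.≤ ℚ.∣ s ℚ.- t ∣ ℚ.+ ℚ.∣ t ℚ.- u ∣
  triangle s t u = subst (λ v → ℚ.∣ v ∣ ℚ.≤ ℚ.∣ s ℚ.- t ∣ ℚ.+ ℚ.∣ t ℚ.- u ∣)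
    (solve 3 (λ s t u → (s :- t) :+ (t :- u) := s :- u) refl s t u)
    (ℚ.∣p+q∣≤∣p∣+∣q∣ (s ℚ.- t) (t ℚ.- u))
    where open ℚSolver.+-*-Solver

  ∣∣-shift : ∀ s t → ℚ.∣ s ∣ ℚ.- ℚ.∣ t ∣ ℚ.≤ ℚ.∣ s ℚ.- t ∣
  ∣∣-shift s t = begin
    ℚ.∣ s ∣ ℚ.- ℚ.∣ t ∣
      ≡⟨ cong (λ v → ℚ.∣ v ∣ ℚ.- ℚ.∣ t ∣) (solve 2 (λ s t → s := (s :- t) :+ t) refl s t) ⟩
    ℚ.∣ (s ℚ.- t) ℚ.+ t ∣ ℚ.- ℚ.∣ t ∣
      ≤⟨ ℚ.+-monoˡ-≤ (ℚ.- ℚ.∣ t ∣) (ℚ.∣p+q∣≤∣p∣+∣q∣ (s ℚ.- t) t) ⟩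
    (ℚ.∣ s ℚ.- t ∣ ℚ.+ ℚ.∣ t ∣) ℚ.- ℚ.∣ t ∣
      ≡⟨ solve 2 (λ v w → (v :+ w) :- w := v) refl ℚ.∣ s ℚ.- t ∣ ℚ.∣ t ∣ ⟩
    ℚ.∣ s ℚ.- t ∣ ∎
    where
    open ℚ.≤-Reasoning
    open ℚSolver.+-*-Solver

  ∣∣-contract : ∀ s t → ℚ.∣ ℚ.∣ s ∣ ℚ.- ℚ.∣ t ∣ ∣ ℚ.≤ ℚ.∣ s ℚ.- t ∣
  ∣∣-contract s t = ∣∣-lub (∣∣-shift s t)
    (subst₂ ℚ._≤_ (solve 2 (λ v w → v :- w := :- (w :- v)) refl ℚ.∣ t ∣ ℚ.∣ s ∣)
                  (∣-∣-sym t s) (∣∣-shift t s))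
    where open ℚSolver.+-*-Solver

  ∣∣-sum : ∀ s t s′ t′ →
    ℚ.∣ (s ℚ.+ t) ℚ.- (s′ ℚ.+ t′) ∣ ℚ.≤ ℚ.∣ s ℚ.- s′ ∣ ℚ.+ ℚ.∣ t ℚ.- t′ ∣
  ∣∣-sum s t s′ t′ = subst (λ v → ℚ.∣ v ∣ ℚ.≤ ℚ.∣ s ℚ.- s′ ∣ ℚ.+ ℚ.∣ t ℚ.- t′ ∣)
    (solve 4 (λ s t s′ t′ → (s :- s′) :+ (t :- t′) := (s :+ t) :- (s′ :+ t′)) refl s t s′ t′)
    (ℚ.∣p+q∣≤∣p∣+∣q∣ (s ℚ.- s′) (t ℚ.- t′))
    where open ℚSolver.+-*-Solver

------------------------------------------------------------------------
-- Bishop's real numbers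

-- Without eta, unification does not unfold the arithmetic below.
record ℝ : Set where
  no-eta-equality
  field
    approx  : ℕ → ℚ
    regular : ∀ m n → ℚ.∣ approx m ℚ.- approx n ∣ ℚ.≤ δ m ℚ.+ δ n

open ℝ public

infix 4 _≃ᵣ_ _≤ᵣ_ _<ᵣ_

record _≃ᵣ_ (x y : ℝ) : Set where
  constructor mk≃
  field
    close : ∀ n → ℚ.∣ approx x n ℚ.- approx y n ∣ ℚ.≤ δ n ℚ.+ δ n

open _≃ᵣ_ public

private

  ≃ᵣ-refl : ∀ {x} → x ≃ᵣ x
  ≃ᵣ-refl {x} = mk≃ λ n → regular x n n

  ≃ᵣ-sym : ∀ {x y} → x ≃ᵣ y → y ≃ᵣ x
  ≃ᵣ-sym {x} {y} x≃y = mk≃ λ n →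
    subst (ℚ._≤ δ n ℚ.+ δ n) (∣-∣-sym (approx x n) (approx y n)) (close x≃y n)

  ≃ᵣ-trans : ∀ {x y z} → x ≃ᵣ y → y ≃ᵣ z → x ≃ᵣ z
  ≃ᵣ-trans {x} {y} {z} x≃y y≃z = mk≃ λ n →
    let d = ℚ.∣ approx x n ℚ.- approx z n ∣
        e = δ n ℚ.+ δ n
        bound : ∀ k → d ℚ.- e ℚ.≤ δ k
        bound k = begin
          d ℚ.- e
            ≤⟨ ℚ.+-monoˡ-≤ (ℚ.- e) (path n (m k)) ⟩
          ((δ n ℚ.+ δ (m k)) ℚ.+ ((δ (m k) ℚ.+ δ (m k)) ℚ.+
            ((δ (m k) ℚ.+ δ (m k)) ℚ.+ (δ (m k) ℚ.+ δ n)))) ℚ.- e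
            ≡⟨ solve 2 (λ v w →
                 ((v :+ w) :+ ((w :+ w) :+ ((w :+ w) :+ (w :+ v)))) :- (v :+ v)
                 := ((w :+ w) :+ (w :+ w)) :+ (w :+ w)) refl (δ n) (δ (m k)) ⟩
          ((δ (m k) ℚ.+ δ (m k)) ℚ.+ (δ (m k) ℚ.+ δ (m k))) ℚ.+ (δ (m k) ℚ.+ δ (m k))
            ≡⟨ cong₂ (λ v w → (v ℚ.+ w) ℚ.+ w) (δ-half (double (double k))) (δ-half (double (double k))) ⟩
          (δ (double (double k)) ℚ.+ δ (double (double k))) ℚ.+ δ (double (double k))
            ≡⟨ cong (ℚ._+ δ (double (double k))) (δ-half (double k)) ⟩
          δ (double k) ℚ.+ δ (double (double k))
            ≤⟨ ℚ.+-monoʳ-≤ (δ (double k)) (δ-double≤ (double k)) ⟩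
          δ (double k) ℚ.+ δ (double k)
            ≡⟨ δ-half k ⟩
          δ k ∎
    in subst₂ ℚ._≤_
         (solve 2 (λ v w → (v :- w) :+ w := v) refl d e)
         (ℚ.+-identityˡ e)
         (ℚ.+-monoˡ-≤ e (archimedean (d ℚ.- e) bound))
    where
    open ℚ.≤-Reasoning
    open ℚSolver.+-*-Solver

    m : ℕ → ℕ
    m k = double (double (double k))

    δ-double≤ : ∀ k → δ (double k) ℚ.≤ δ k
    δ-double≤ k = subst₂ ℚ._≤_ (ℚ.+-identityˡ (δ (double k))) (δ-half k)
      (ℚ.+-monoˡ-≤ (δ (double k)) (0≤δ (double k)))

    path : ∀ n k → ℚ.∣ approx x n ℚ.- approx z n ∣ ℚ.≤
      (δ n ℚ.+ δ k) ℚ.+ ((δ k ℚ.+ δ k) ℚ.+ ((δ k ℚ.+ δ k) ℚ.+ (δ k ℚ.+ δ n)))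
    path n k =
      ℚ.≤-trans (triangle (approx x n) (approx x k) (approx z n)) (ℚ.+-mono-≤ (regular x n k)
      (ℚ.≤-trans (triangle (approx x k) (approx y k) (approx z n)) (ℚ.+-mono-≤ (close x≃y k)
      (ℚ.≤-trans (triangle (approx y k) (approx z k) (approx z n)) (ℚ.+-mono-≤ (close y≃z k)
      (regular z k n))))))

ℝₛ : Setoid 0ℓ 0ℓ
ℝₛ = record
  { Carrier       = ℝ
  ; _≈_           = _≃ᵣ_
  ; isEquivalence = record { refl = ≃ᵣ-refl ; sym = ≃ᵣ-sym ; trans = ≃ᵣ-trans }
  }

fromℚ : ℚ → ℝ
fromℚ s .approx _ = s
fromℚ s .regular m n = subst (ℚ._≤ δ m ℚ.+ δ n)
  (cong ℚ.∣_∣ (sym (ℚ.+-inverseʳ s)))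
  (ℚ.+-mono-≤ (0≤δ m) (0≤δ n))

fromℕ : ℕ → ℝ
fromℕ n = fromℚ (+ n ℚ./ 1)

0ᵣ : ℝ
0ᵣ = fromℕ 0

infixl 6 _+ᵣ_ _-ᵣ_
infix  8 -ᵣ_

_+ᵣ_ : ℝ → ℝ → ℝ
(x +ᵣ y) .approx n = approx x (double n) ℚ.+ approx y (double n)
(x +ᵣ y) .regular m n = begin
  _ ≤⟨ ∣∣-sum (approx x (double m)) (approx y (double m))
              (approx x (double n)) (approx y (double n)) ⟩
  _ ≤⟨ ℚ.+-mono-≤ (regular x (double m) (double n)) (regular y (double m) (double n)) ⟩
  (δ (double m) ℚ.+ δ (double n)) ℚ.+ (δ (double m) ℚ.+ δ (double n))
    ≡⟨ solve 2 (λ v w → (v :+ w) :+ (v :+ w) := (v :+ v) :+ (w :+ w)) refl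
         (δ (double m)) (δ (double n)) ⟩
  (δ (double m) ℚ.+ δ (double m)) ℚ.+ (δ (double n) ℚ.+ δ (double n))
    ≡⟨ cong₂ ℚ._+_ (δ-half m) (δ-half n) ⟩
  δ m ℚ.+ δ n ∎
  where
  open ℚ.≤-Reasoning
  open ℚSolver.+-*-Solver

+ᵣ-cong : ∀ {x x′ y y′} → x ≃ᵣ x′ → y ≃ᵣ y′ → x +ᵣ y ≃ᵣ x′ +ᵣ y′
+ᵣ-cong {x} {x′} {y} {y′} x≃x′ y≃y′ = mk≃ λ n → begin
  _ ≤⟨ ∣∣-sum (approx x (double n)) (approx y (double n))
              (approx x′ (double n)) (approx y′ (double n)) ⟩
  _ ≤⟨ ℚ.+-mono-≤ (close x≃x′ (double n)) (close y≃y′ (double n)) ⟩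
  (δ (double n) ℚ.+ δ (double n)) ℚ.+ (δ (double n) ℚ.+ δ (double n))
    ≡⟨ cong₂ ℚ._+_ (δ-half n) (δ-half n) ⟩
  δ n ℚ.+ δ n ∎
  where open ℚ.≤-Reasoning

-ᵣ_ : ℝ → ℝ
(-ᵣ x) .approx n = ℚ.- approx x n
(-ᵣ x) .regular m n = subst (ℚ._≤ δ m ℚ.+ δ n)
  (trans (∣-∣-sym (approx x m) (approx x n)) (cong ℚ.∣_∣
    (solve 2 (λ v w → w :- v := (:- v) :- (:- w)) refl (approx x m) (approx x n))))
  (regular x m n)
  where open ℚSolver.+-*-Solver

_-ᵣ_ : ℝ → ℝ → ℝ
x -ᵣ y = x +ᵣ (-ᵣ y)

∣_∣ᵣ : ℝ → ℝ
∣ x ∣ᵣ .approx n = ℚ.∣ approx x n ∣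
∣ x ∣ᵣ .regular m n = ℚ.≤-trans (∣∣-contract (approx x m) (approx x n)) (regular x m n)

-- Bishop's nonnegativity (uₙ ≥ -1/n for all n) and positivity (uₙ > 1/n for
-- some n) of the difference u = y - x.
_≤ᵣ_ : ℝ → ℝ → Set
x ≤ᵣ y = ∀ n → ℚ.- δ n ℚ.≤ approx (y -ᵣ x) n

_<ᵣ_ : ℝ → ℝ → Set
x <ᵣ y = ∃[ n ] δ n ℚ.< approx (y -ᵣ x) n

------------------------------------------------------------------------
-- Real-valued functions

infixr 9 _∘ₛ_

_∘ₛ_ : {X : Setoid a ℓ₁} {Y : Setoid b ℓ₂} {Z : Setoid c ℓ₃} →
       Func Y Z → Func X Y → Func X Z
g ∘ₛ f = Composition.function f g

infix 4 _≐_

_≐_ : {X : Setoid a ℓ₁} {Y : Setoid b ℓ₂} → Func X Y → Func X Y → Set (a ⊔ ℓ₂)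
_≐_ {X = X} {Y = Y} = Setoid._≈_ (X ⇨ Y)

constₛ : (X : Setoid a ℓ) → ℝ → Func X ℝₛ
constₛ X s = record { to = λ _ → s ; cong = λ _ → ≃ᵣ-refl }

infixl 6 _+ₛ_

_+ₛ_ : {X : Setoid a ℓ} → Func X ℝₛ → Func X ℝₛ → Func X ℝₛ
f +ₛ g = record
  { to   = λ x → (f ⟨$⟩ x) +ᵣ (g ⟨$⟩ x)
  ; cong = λ x≈y → +ᵣ-cong (Func.cong f x≈y) (Func.cong g x≈y)
  }

[-n,n] : ℕ → Pred ℝ 0ℓ
[-n,n] n x = (-ᵣ fromℕ n ≤ᵣ x) × (x ≤ᵣ fromℕ n)

-- Uniform continuity on every interval [-n,n].
Bic : Pred (Func ℝₛ ℝₛ) 0ℓ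
Bic φ = ∀ (n : ℕ) (ε : ℝ) → 0ᵣ <ᵣ ε →
  Σ[ ω ∈ ℝ ] (0ᵣ <ᵣ ω) ×
    (∀ x y → x ∈ [-n,n] n → y ∈ [-n,n] n →
      ∣ x -ᵣ y ∣ᵣ <ᵣ ω → ∣ (φ ⟨$⟩ x) -ᵣ (φ ⟨$⟩ y) ∣ᵣ ≤ᵣ ε)

UniformlyWithin : {X : Setoid a ℓ} → ℝ → Func X ℝₛ → Func X ℝₛ → Set a
UniformlyWithin {X = X} ε f g =
  ∀ (x : Setoid.Carrier X) → ∣ (f ⟨$⟩ x) -ᵣ (g ⟨$⟩ x) ∣ᵣ ≤ᵣ ε

------------------------------------------------------------------------
-- Bishop spaces

record IsBishopTopology {X : Setoid a ℓ} (F : Pred (Func X ℝₛ) p) :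
       Set (a ⊔ ℓ ⊔ p) where
  field
    resp-≐  : ∀ {f g} → f ≐ g → f ∈ F → g ∈ F
    const-∈ : ∀ s → constₛ X s ∈ F
    +-∈     : ∀ {f g} → f ∈ F → g ∈ F → f +ₛ g ∈ F
    Bic-∈   : ∀ φ {f} → φ ∈ Bic → f ∈ F → φ ∘ₛ f ∈ F
    lim-∈   : ∀ {f} →
              (∀ ε → 0ᵣ <ᵣ ε → Σ[ g ∈ Func X ℝₛ ] (g ∈ F) × UniformlyWithin ε f g) →
              f ∈ F

-- The least Bishop topology containing F₀, generated inductively; leastness
-- is ⋁-least below.
data ⋁ {X : Setoid a ℓ} (F₀ : Pred (Func X ℝₛ) p) :
       Pred (Func X ℝₛ) (a ⊔ ℓ ⊔ p) where
  gen   : ∀ {f} → f ∈ F₀ → f ∈ ⋁ F₀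
  resp  : ∀ {f g} → f ≐ g → f ∈ ⋁ F₀ → g ∈ ⋁ F₀
  const : ∀ s → constₛ X s ∈ ⋁ F₀
  add   : ∀ {f g} → f ∈ ⋁ F₀ → g ∈ ⋁ F₀ → f +ₛ g ∈ ⋁ F₀
  bic   : ∀ φ {f} → φ ∈ Bic → f ∈ ⋁ F₀ → φ ∘ₛ f ∈ ⋁ F₀
  lim   : ∀ {f} →
          (∀ ε → 0ᵣ <ᵣ ε → Σ[ g ∈ Func X ℝₛ ] (g ∈ ⋁ F₀) × UniformlyWithin ε f g) →
          f ∈ ⋁ F₀

⋁-isBishopTopology : {X : Setoid a ℓ} (F₀ : Pred (Func X ℝₛ) p) →
                     IsBishopTopology (⋁ F₀)
⋁-isBishopTopology F₀ = record
  { resp-≐ = resp ; const-∈ = const ; +-∈ = add ; Bic-∈ = bic ; lim-∈ = lim }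

⋁-least : {X : Setoid a ℓ} {F₀ : Pred (Func X ℝₛ) p} {F : Pred (Func X ℝₛ) q} →
          IsBishopTopology F → (∀ {f} → f ∈ F₀ → f ∈ F) →
          ∀ {f} → f ∈ ⋁ F₀ → f ∈ F
⋁-least {F₀ = F₀} {F = F} isF F₀⊆F = go
  where
  open IsBishopTopology isF
  go : ∀ {f} → f ∈ ⋁ F₀ → f ∈ F
  go (gen f∈F₀)   = F₀⊆F f∈F₀
  go (resp e f∈)  = resp-≐ e (go f∈)
  go (const s)    = const-∈ s
  go (add f∈ g∈)  = +-∈ (go f∈) (go g∈)
  go (bic φ φ∈ f∈) = Bic-∈ φ φ∈ (go f∈)
  go (lim approximable) = lim-∈ λ ε 0<ε →
    let g , g∈ , within = approximable ε 0<ε in g , go g∈ , within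

record BishopSpace a ℓ p : Set (lsuc (a ⊔ ℓ ⊔ p)) where
  field
    set              : Setoid a ℓ
    topology         : Pred (Func set ℝₛ) p
    isBishopTopology : IsBishopTopology topology

  open Setoid set public using (Carrier; _≈_)

generatedBy : (X : Setoid a ℓ) → Pred (Func X ℝₛ) p → BishopSpace a ℓ (a ⊔ ℓ ⊔ p)
generatedBy X F₀ = record
  { set = X ; topology = ⋁ F₀ ; isBishopTopology = ⋁-isBishopTopology F₀ }

IsBishopMorphism : (𝓕 : BishopSpace a ℓ p) (𝓖 : BishopSpace b ℓ₁ q) →
                   Pred (Func (BishopSpace.set 𝓕) (BishopSpace.set 𝓖)) (b ⊔ ℓ₁ ⊔ p ⊔ q)
IsBishopMorphism 𝓕 𝓖 h =
  ∀ {g} → g ∈ BishopSpace.topology 𝓖 → g ∘ₛ h ∈ BishopSpace.topology 𝓕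

record Mor (𝓕 : BishopSpace a ℓ p) (𝓖 : BishopSpace b ℓ₁ q) :
       Set (a ⊔ ℓ ⊔ p ⊔ b ⊔ ℓ₁ ⊔ q) where
  constructor mkMor
  field
    func       : Func (BishopSpace.set 𝓕) (BishopSpace.set 𝓖)
    isMorphism : func ∈ IsBishopMorphism 𝓕 𝓖

open Mor public

infixr 9 _∘ₘ_

_∘ₘ_ : {𝓕 : BishopSpace a ℓ p} {𝓖 : BishopSpace b ℓ₁ q} {𝓗 : BishopSpace c ℓ₂ r} →
       Mor 𝓖 𝓗 → Mor 𝓕 𝓖 → Mor 𝓕 𝓗
k ∘ₘ h = mkMor (func k ∘ₛ func h) (λ {g} g∈ → isMorphism h {g ∘ₛ func k} (isMorphism k g∈))

MorSetoid : (𝓕 : BishopSpace a ℓ p) (𝓖 : BishopSpace b ℓ₁ q) →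
            Setoid (a ⊔ ℓ ⊔ p ⊔ b ⊔ ℓ₁ ⊔ q) (a ⊔ ℓ₁)
MorSetoid 𝓕 𝓖 = On.setoid (BishopSpace.set 𝓕 ⇨ BishopSpace.set 𝓖) (func {𝓕 = 𝓕} {𝓖 = 𝓖})

record _≃_ (𝓕 : BishopSpace a ℓ p) (𝓖 : BishopSpace b ℓ₁ q) :
       Set (a ⊔ ℓ ⊔ p ⊔ b ⊔ ℓ₁ ⊔ q) where
  field
    to      : Mor 𝓕 𝓖
    from    : Mor 𝓖 𝓕
    inverse : Inverseᵇ (BishopSpace._≈_ 𝓕) (BishopSpace._≈_ 𝓖)
                       (func to ⟨$⟩_) (func from ⟨$⟩_)

infix 4 _≃_

module _ (𝓕 : BishopSpace a ℓ p) (𝓖 : BishopSpace b ℓ₁ q) where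
  private
    module 𝓕 = BishopSpace 𝓕
    module 𝓖 = BishopSpace 𝓖

  evalThen : 𝓕.Carrier → Func 𝓖.set ℝₛ → Func (MorSetoid 𝓕 𝓖) ℝₛ
  evalThen x g = record
    { to   = λ h → g ⟨$⟩ (func h ⟨$⟩ x)
    ; cong = λ h≈k → Func.cong g (h≈k x)
    }

  Evaluations : Pred (Func (MorSetoid 𝓕 𝓖) ℝₛ) (a ⊔ ℓ ⊔ p ⊔ b ⊔ ℓ₁ ⊔ q)
  Evaluations f = ∃[ x ] ∃[ g ] (g ∈ 𝓖.topology) × (evalThen x g ≐ f)

  infixr 5 _⇒_

  _⇒_ : BishopSpace (a ⊔ ℓ ⊔ p ⊔ b ⊔ ℓ₁ ⊔ q) (a ⊔ ℓ₁) (a ⊔ ℓ ⊔ p ⊔ b ⊔ ℓ₁ ⊔ q)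
  _⇒_ = generatedBy (MorSetoid 𝓕 𝓖) Evaluations

-- A map into a generated space is a morphism once it is so on generators.
morphism-from-generators :
  (𝓕 : BishopSpace a ℓ p) {Y : Setoid b ℓ₁} {G₀ : Pred (Func Y ℝₛ) q}
  (h : Func (BishopSpace.set 𝓕) Y) →
  (∀ {g} → g ∈ G₀ → g ∘ₛ h ∈ BishopSpace.topology 𝓕) →
  h ∈ IsBishopMorphism 𝓕 (generatedBy Y G₀)
morphism-from-generators 𝓕 {G₀ = G₀} h on-gen = go
  where
  module 𝓕 = BishopSpace 𝓕
  open IsBishopTopology 𝓕.isBishopTopology
  go : ∀ {g} → g ∈ ⋁ G₀ → g ∘ₛ h ∈ 𝓕.topology
  go (gen g∈)    = on-gen g∈
  go (resp e g∈) = resp-≐ (λ x → e (h ⟨$⟩ x)) (go g∈)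
  go (const s)   = resp-≐ (λ _ → ≃ᵣ-refl) (const-∈ s)
  go (add f∈ g∈) = resp-≐ (λ _ → ≃ᵣ-refl) (+-∈ (go f∈) (go g∈))
  go (bic φ φ∈ g∈) = resp-≐ (λ _ → ≃ᵣ-refl) (Bic-∈ φ φ∈ (go g∈))
  go (lim approximable) = lim-∈ λ ε 0<ε →
    let g , g∈ , within = approximable ε 0<ε
    in g ∘ₛ h , go g∈ , λ x → within (h ⟨$⟩ x)

------------------------------------------------------------------------
-- Direct spectra

-- A preorder's reflexivity field _≈_ ⇒ _≲_ amounts to reflexivity of _≲_
-- together with its respecting _≈_.
record DirectedSet c ℓ₁ ℓ₂ : Set (lsuc (c ⊔ ℓ₁ ⊔ ℓ₂)) where
  field
    preorder : Preorder c ℓ₁ ℓ₂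

  open Preorder preorder public
    using () renaming (Carrier to Index; _≲_ to _≼_; refl to ≼-refl; trans to ≼-trans)

  field
    upperBound : ∀ i j → ∃[ k ] (i ≼ k) × (j ≼ k)

-- The laws quantify over all proofs of the order relation, so that transport
-- depends, up to equality, on the indices alone.
record DirectSpectrum (I : DirectedSet c ℓ₁ ℓ₂) a ℓ p :
       Set (c ⊔ ℓ₂ ⊔ lsuc (a ⊔ ℓ ⊔ p)) where
  open DirectedSet I
  field
    space     : Index → BishopSpace a ℓ p
    transport : ∀ {i j} → i ≼ j → Mor (space i) (space j)
    identity  : ∀ {i} (i≼i : i ≼ i) →
                func (transport i≼i) ≐ Identity.function (BishopSpace.set (space i))
    compose   : ∀ {i j k} (i≼j : i ≼ j) (j≼k : j ≼ k) (i≼k : i ≼ k) →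
                func (transport i≼k) ≐ func (transport j≼k) ∘ₛ func (transport i≼j)

record ContravariantDirectSpectrum (I : DirectedSet c ℓ₁ ℓ₂) a ℓ p :
       Set (c ⊔ ℓ₂ ⊔ lsuc (a ⊔ ℓ ⊔ p)) where
  open DirectedSet I
  field
    space     : Index → BishopSpace a ℓ p
    transport : ∀ {i j} → i ≼ j → Mor (space j) (space i)
    identity  : ∀ {i} (i≼i : i ≼ i) →
                func (transport i≼i) ≐ Identity.function (BishopSpace.set (space i))
    compose   : ∀ {i j k} (i≼j : i ≼ j) (j≼k : j ≼ k) (i≼k : i ≼ k) →
                func (transport i≼k) ≐ func (transport i≼j) ∘ₛ func (transport j≼k)

------------------------------------------------------------------------
-- Direct limits

module _ {I : DirectedSet c ℓ₁ ℓ₂} (S : DirectSpectrum I a ℓ p) where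
  open DirectedSet I
  open DirectSpectrum S
  private
    module Sp i = BishopSpace (space i)
    module St i = Setoid (Sp.set i)

    λ↦ : ∀ {i j} → i ≼ j → Sp.Carrier i → Sp.Carrier j
    λ↦ i≼j x = func (transport i≼j) ⟨$⟩ x

  -- A class eql₀(i,x) is represented by the pair (i,x) itself, and equality of
  -- classes is the equality of the pairs.
  EqualInLimit : (u v : Σ Index Sp.Carrier) → Set (c ⊔ ℓ₂ ⊔ ℓ)
  EqualInLimit (i , x) (j , y) =
    ∃[ k ] Σ[ i≼k ∈ i ≼ k ] Σ[ j≼k ∈ j ≼ k ] Sp._≈_ k (λ↦ i≼k x) (λ↦ j≼k y)

  directLimitSet : Setoid (c ⊔ a) (c ⊔ ℓ₂ ⊔ ℓ)
  directLimitSet = record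
    { Carrier       = Σ Index Sp.Carrier
    ; _≈_           = EqualInLimit
    ; isEquivalence = record
      { refl  = λ { {i , x} → i , ≼-refl , ≼-refl , St.refl i }
      ; sym   = λ { (k , i≼k , j≼k , e) → k , j≼k , i≼k , St.sym k e }
      ; trans = λ { {i , x} {j , y} {l , z} (k , i≼k , j≼k , e) (m , j≼m , l≼m , e′) →
          let n , k≼n , m≼n = upperBound k m
              i≼n = ≼-trans i≼k k≼n
              j≼n = ≼-trans j≼k k≼n
              l≼n = ≼-trans l≼m m≼n
              open Setoid (Sp.set n) using () renaming (sym to sym′; trans to _▷_)
          in n , i≼n , l≼n ,
             compose i≼k k≼n i≼n x
             ▷ (Func.cong (func (transport k≼n)) e
             ▷ (sym′ (compose j≼k k≼n j≼n y)
             ▷ (compose j≼m m≼n j≼n y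
             ▷ (Func.cong (func (transport m≼n)) e′
             ▷ sym′ (compose l≼m m≼n l≼n z))))) }
      }
    }

  record CompatibleFunctions : Set (c ⊔ ℓ₂ ⊔ a ⊔ ℓ ⊔ p) where
    field
      component  : ∀ i → Func (Sp.set i) ℝₛ
      component∈ : ∀ i → component i ∈ Sp.topology i
      compatible : ∀ {i j} (i≼j : i ≼ j) →
                   component i ≐ component j ∘ₛ func (transport i≼j)

  limitFunction : CompatibleFunctions → Func directLimitSet ℝₛ
  limitFunction Θ = record
    { to   = λ { (i , x) → component i ⟨$⟩ x }
    ; cong = λ { {i , x} {j , y} (k , i≼k , j≼k , e) →
        ≃ᵣ-trans (compatible i≼k x)
          (≃ᵣ-trans (Func.cong (component k) e) (≃ᵣ-sym (compatible j≼k y))) }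
    }
    where open CompatibleFunctions Θ

  LimitFunctions : Pred (Func directLimitSet ℝₛ) (c ⊔ ℓ₂ ⊔ a ⊔ ℓ ⊔ p)
  LimitFunctions f = ∃[ Θ ] (limitFunction Θ ≐ f)

  Lim→ : BishopSpace (c ⊔ a) (c ⊔ ℓ₂ ⊔ ℓ) (c ⊔ ℓ₂ ⊔ a ⊔ ℓ ⊔ p)
  Lim→ = generatedBy directLimitSet LimitFunctions

------------------------------------------------------------------------
-- Inverse limits

module _ {I : DirectedSet c ℓ₁ ℓ₂} (S : ContravariantDirectSpectrum I a ℓ p) where
  open DirectedSet I
  open ContravariantDirectSpectrum S
  private
    module Sp i = BishopSpace (space i)
    module St i = Setoid (Sp.set i)

  record CompatibleElements : Set (c ⊔ ℓ₂ ⊔ a ⊔ ℓ) where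
    field
      component  : ∀ i → Sp.Carrier i
      compatible : ∀ {i j} (i≼j : i ≼ j) →
                   Sp._≈_ i (component i) (func (transport i≼j) ⟨$⟩ component j)

  open CompatibleElements

  inverseLimitSet : Setoid (c ⊔ ℓ₂ ⊔ a ⊔ ℓ) (c ⊔ ℓ)
  inverseLimitSet = record
    { Carrier       = CompatibleElements
    ; _≈_           = λ Φ Ψ → ∀ i → Sp._≈_ i (component Φ i) (component Ψ i)
    ; isEquivalence = record
      { refl  = λ i → St.refl i
      ; sym   = λ e i → St.sym i (e i)
      ; trans = λ e e′ i → St.trans i (e i) (e′ i)
      }
    }

  projection : ∀ i → Func inverseLimitSet (Sp.set i)
  projection i = record { to = λ Φ → component Φ i ; cong = λ e → e i }

  ProjectedFunctions : Pred (Func inverseLimitSet ℝₛ) (c ⊔ ℓ₂ ⊔ a ⊔ ℓ ⊔ p)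
  ProjectedFunctions f = ∃[ i ] ∃[ g ] (g ∈ Sp.topology i) × (g ∘ₛ projection i ≐ f)

  Lim← : BishopSpace (c ⊔ ℓ₂ ⊔ a ⊔ ℓ) (c ⊔ ℓ) (c ⊔ ℓ₂ ⊔ a ⊔ ℓ ⊔ p)
  Lim← = generatedBy inverseLimitSet ProjectedFunctions

------------------------------------------------------------------------
-- The contravariant spectrum of morphisms into a fixed space

precompose : {𝓕 : BishopSpace a ℓ p} {𝓖 : BishopSpace b ℓ₁ q} (𝓗 : BishopSpace c ℓ₂ r) →
             Mor 𝓕 𝓖 → Mor (𝓖 ⇒ 𝓗) (𝓕 ⇒ 𝓗)
precompose {𝓕 = 𝓕} {𝓖 = 𝓖} 𝓗 h = mkMor h⁺
  (morphism-from-generators (𝓖 ⇒ 𝓗) h⁺ λ { (x , g , g∈ , e) →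
    gen (func h ⟨$⟩ x , g , g∈ , λ φ → e (φ ∘ₘ h)) })
  where
  h⁺ : Func (MorSetoid 𝓖 𝓗) (MorSetoid 𝓕 𝓗)
  h⁺ = record
    { to   = λ φ → φ ∘ₘ h
    ; cong = λ φ≈ψ x → φ≈ψ (func h ⟨$⟩ x)
    }

infixr 5 _⇒ₛ_

_⇒ₛ_ : {I : DirectedSet c ℓ₁ ℓ₂} → DirectSpectrum I a ℓ p → (𝓕 : BishopSpace b ℓ₃ q) →
       ContravariantDirectSpectrum I (a ⊔ ℓ ⊔ p ⊔ b ⊔ ℓ₃ ⊔ q) (a ⊔ ℓ₃) (a ⊔ ℓ ⊔ p ⊔ b ⊔ ℓ₃ ⊔ q)
S ⇒ₛ 𝓕 = record
  { space     = λ i → space i ⇒ 𝓕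
  ; transport = λ i≼j → precompose 𝓕 (transport i≼j)
  ; identity  = λ i≼i φ x → Func.cong (func φ) (identity i≼i x)
  ; compose   = λ i≼j j≼k i≼k φ x → Func.cong (func φ) (compose i≼j j≼k i≼k x)
  }
  where open DirectSpectrum S

{-# OPTIONS --safe #-}
module Submission where

open import Defs
open import Data.Product using (_,_)
open import Function.Bundles using (Func; _⟨$⟩_)
open import Level using (Level)
open import Relation.Binary.Bundles using (Setoid)
import Relation.Binary.Reasoning.Setoid as ≈-Reasoning

private
  variable
    c ℓ₁ ℓ₂ a ℓ p b ℓ₃ q : Level

-- The direct limit is a colimit of Bishop spaces: a morphism `h` out of it amounts to the
-- compatible family of its restrictions `h ∘ₘ eql i`, and a compatible family `Φ` glues back by
-- sending `(i , x)` to `Φ` at `i` applied to `x`. Gluing and restricting are morphisms because both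
-- target topologies are generated, so only generators need pulling back, and these match:
-- evaluation at `(i , x)` on one side is evaluation at `x` after the `i`-th projection on the
-- other.

module _ {I : DirectedSet c ℓ₁ ℓ₂} (S : DirectSpectrum I a ℓ p) where
  open DirectedSet I
  open DirectSpectrum S
  private
    module Sp i = BishopSpace (space i)
    module Lim = BishopSpace (Lim→ S)

  -- A generator given by `Θ` pulls back to the component of `Θ` at `i`, which lies in the topology
  -- by assumption.
  eql : ∀ i → Mor (space i) (Lim→ S)
  eql i = mkMor eqlᶠ (morphism-from-generators (space i) eqlᶠ λ { (Θ , Θ≐f) →
      IsBishopTopology.resp-≐ (Sp.isBishopTopology i)
        (λ x → Θ≐f (i , x)) (CompatibleFunctions.component∈ Θ i) })
    where
    eqlᶠ : Func (Sp.set i) Lim.set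
    eqlᶠ = record
      { to   = i ,_
      ; cong = λ x≈y → i , ≼-refl , ≼-refl , Func.cong (func (transport ≼-refl)) x≈y
      }

  -- The cocone law, which makes restrictions compatible; `j` itself serves as the common upper
  -- bound.
  eql-transport : ∀ {i j} (i≼j : i ≼ j) →
                  func (eql i) ≐ func (eql j) ∘ₛ func (transport i≼j)
  eql-transport {j = j} i≼j x =
    j , i≼j , ≼-refl , Setoid.sym (Sp.set j) (identity ≼-refl (func (transport i≼j) ⟨$⟩ x))

  module _ (𝓕 : BishopSpace b ℓ₃ q) where
    private
      module 𝓕 = BishopSpace 𝓕
      module Inv = BishopSpace (Lim← (S ⇒ₛ 𝓕))
      module Exp = BishopSpace (Lim→ S ⇒ 𝓕)
    open CompatibleElements

    glue : Inv.Carrier → Mor (Lim→ S) 𝓕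
    -- The functions `g ∘ₛ func (component Φ i)` form a compatible family, so `g ∘ₛ glued` is itself
    -- a generator.
    glue Φ = mkMor glued λ {g} g∈ →
        gen (record
          { component  = λ i → g ∘ₛ func (component Φ i)
          ; component∈ = λ i → isMorphism (component Φ i) {g} g∈
          ; compatible = λ i≼j x → Func.cong g (compatible Φ i≼j x)
          } , λ _ → Setoid.refl ℝₛ)
      where
      glued : Func Lim.set 𝓕.set
      glued = record
        { to   = λ { (i , x) → func (component Φ i) ⟨$⟩ x }
        ; cong = λ { {i , x} {j , y} (k , i≼k , j≼k , e) → begin
            func (component Φ i) ⟨$⟩ x
              ≈⟨ compatible Φ i≼k x ⟩
            func (component Φ k) ⟨$⟩ (func (transport i≼k) ⟨$⟩ x)
              ≈⟨ Func.cong (func (component Φ k)) e ⟩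
            func (component Φ k) ⟨$⟩ (func (transport j≼k) ⟨$⟩ y)
              ≈⟨ compatible Φ j≼k y ⟨
            func (component Φ j) ⟨$⟩ y ∎ }
        }
        where open ≈-Reasoning 𝓕.set

    glueₘ : Mor (Lim← (S ⇒ₛ 𝓕)) (Lim→ S ⇒ 𝓕)
    glueₘ = mkMor glueᶠ (morphism-from-generators (Lim← (S ⇒ₛ 𝓕)) glueᶠ
      λ { ((i , x) , g , g∈ , e) →
        gen (i , evalThen (space i) 𝓕 x g , gen (x , g , g∈ , λ _ → Setoid.refl ℝₛ) ,
             λ Φ → e (glue Φ)) })
      where
      glueᶠ : Func Inv.set Exp.set
      glueᶠ = record { to = glue ; cong = λ { Φ≈Ψ (i , x) → Φ≈Ψ i x } }

    restrict : Mor (Lim→ S) 𝓕 → Inv.Carrier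
    restrict h = record
      { component  = λ i → h ∘ₘ eql i
      ; compatible = λ i≼j x → Func.cong (func h) (eql-transport i≼j x)
      }

    -- On each generator g ∘ π_i, restriction is precomposition with eql i,
    -- already known to be a morphism of exponentials.
    restrictₘ : Mor (Lim→ S ⇒ 𝓕) (Lim← (S ⇒ₛ 𝓕))
    restrictₘ = mkMor restrictᶠ (morphism-from-generators (Lim→ S ⇒ 𝓕) restrictᶠ
      λ { (i , g , g∈ , e) →
        resp (λ h → e (restrict h)) (isMorphism (precompose 𝓕 (eql i)) {g} g∈) })
      where
      restrictᶠ : Func Exp.set Inv.set
      restrictᶠ = record { to = restrict ; cong = λ h≈k i x → h≈k (i , x) }

theorem11p3 : {c ℓ₁ ℓ₂ a ℓ p b ℓ₃ q : Level}
    (I : DirectedSet c ℓ₁ ℓ₂)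
    (S : DirectSpectrum I a ℓ p)
    (𝓕 : BishopSpace b ℓ₃ q) →
    Lim← (S ⇒ₛ 𝓕) ≃ (Lim→ S ⇒ 𝓕)
theorem11p3 I S 𝓕 = record
  { to      = glueₘ S 𝓕
  ; from    = restrictₘ S 𝓕
  -- Both composites compute pointwise to the original values, so only currying of the equality
  -- proofs remains.
  ; inverse = (λ { e (i , x) → e i x }) , λ e i x → e (i , x)
  }
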